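{- Let $d$ be a positive odd integer divisible by $3$, let $a$ be an integer with $a\equiv 1 \pmod{12}$, and let $b=2^d a-3$. Then the equation $$ax^d-y^2-z^2+xyz-b=0$$ has no solution $(x,y,z)\in\mathbb{Z}^3$. -}

module Defs where

{-# OPTIONS --safe #-}
module Submission where

-- Modulo x - 2 the equation becomes (y - z)² ≡ 3.  A natural number n ≡ ±5 (mod 12) never divides
-- i² - 3: since n is odd, i may be taken even with 0 ≤ i < n, and then the cofactor of n in i² - 3
-- (or a third of it, if 3 ∣ i) is again ≡ ±5 (mod 12) and smaller than n, so descent applies.
-- On the other hand the equation modulo 12 forces x ≡ 9 or x ≡ 5 (mod 12).  In the first case
-- x - 2 ≡ 7 (mod 12); in the second the equation modulo 9 gives x ≡ 8 (mod 9), so that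
-- (x - 2) / 3 ≡ 5 (mod 12).  Powers are controlled by xᵈ ≡ x³ (mod 36) for odd multiples d of 3.

open import Defs
open import Data.Nat using (ℕ)
open import Data.Integer using (ℤ; 0ℤ; 1ℤ; +_; _+_; _-_; _*_; _^_)
open import Data.Integer.Divisibility using (_∣_)
open import Data.Product using (∃-syntax)
open import Relation.Nullary using (¬_)
open import Relation.Binary.PropositionalEquality using (_≡_)
import Data.Nat as ℕ using (_<_)
import Data.Nat.Divisibility as ℕ using (_∣_)

open import Data.Empty using (⊥; ⊥-elim)
open import Data.Fin using (Fin; toℕ; fromℕ<)
open import Data.Fin.Properties using (all?; toℕ-fromℕ<)
open import Data.Integer using (-_; -[1+_]; ∣_∣)
open import Data.Integer.DivMod using (_%ℕ_; _/ℕ_; a≡a%ℕn+[a/ℕn]*n; n%ℕd<d)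
import Data.Integer.Divisibility.Signed as Signed
import Data.Integer.Properties as ℤₚ
open import Algebra.Properties.AbelianGroup ℤₚ.+-0-abelianGroup using (∙-cancelˡ)
open import Data.Integer.Tactic.RingSolver using (solve-∀)
open import Data.Nat using (zero; suc; NonZero; s≤s; z≤n)
import Data.Nat as ℕ using (_+_; _*_; _≤_; _%_; _∸_; _≟_)
import Data.Nat.DivMod as ℕ
import Data.Nat.Divisibility as ℕ using (divides; m%n≡0⇒n∣m)
open import Data.Nat.Induction using (<-rec)
import Data.Nat.Properties as ℕₚ
import Data.Nat.Tactic.RingSolver as ℕSolver using (solve-∀)
open import Data.Product using (_×_; _,_)
open import Data.Sum as Sum using (_⊎_; inj₁; inj₂)
open import Relation.Binary.PropositionalEquality using (refl; sym; trans; cong; cong₂; subst)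
open import Relation.Nullary.Decidable using (Dec; from-yes; _→-dec_; _⊎-dec_; _×-dec_; ¬?)

-- Congruences between integers modulo a natural number.

infix 4 _≡_[mod_]

-- The signed quotient is kept as data: the descent below splits on its sign and takes it as the
-- cofactor.
record _≡_[mod_] (i j : ℤ) (m : ℕ) : Set where
  constructor congruent
  field
    quotient : ℤ
    equality : i ≡ j + quotient * + m

mod-reflexive : ∀ {m i j} → i ≡ j → i ≡ j [mod m ]
mod-reflexive {m} {i} refl = congruent 0ℤ (lemma i (+ m))
  where
  lemma : ∀ i k → i ≡ i + 0ℤ * k
  lemma = solve-∀

mod-refl : ∀ {m i} → i ≡ i [mod m ]
mod-refl = mod-reflexive refl

mod-sym : ∀ {m i j} → i ≡ j [mod m ] → j ≡ i [mod m ]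
mod-sym {m} {i} {j} (congruent q eq) =
  congruent (- q) (trans (lemma j q (+ m)) (cong (_+ - q * + m) (sym eq)))
  where
  lemma : ∀ j q k → j ≡ j + q * k + - q * k
  lemma = solve-∀

mod-trans : ∀ {m i j k} → i ≡ j [mod m ] → j ≡ k [mod m ] → i ≡ k [mod m ]
mod-trans {m} {k = k} (congruent p refl) (congruent q refl) = congruent (p + q) (lemma k p q (+ m))
  where
  lemma : ∀ k p q m → k + q * m + p * m ≡ k + (p + q) * m
  lemma = solve-∀

+-mod : ∀ {m i i′ j j′} → i ≡ i′ [mod m ] → j ≡ j′ [mod m ] → i + j ≡ i′ + j′ [mod m ]
+-mod {m} {i′ = i} {j′ = j} (congruent p refl) (congruent q refl) =
  congruent (p + q) (lemma i j p q (+ m))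
  where
  lemma : ∀ i j p q m → i + p * m + (j + q * m) ≡ i + j + (p + q) * m
  lemma = solve-∀

*-mod : ∀ {m i i′ j j′} → i ≡ i′ [mod m ] → j ≡ j′ [mod m ] → i * j ≡ i′ * j′ [mod m ]
*-mod {m} {i′ = i} {j′ = j} (congruent p refl) (congruent q refl) =
  congruent (p * j + i * q + p * q * + m) (lemma i j p q (+ m))
  where
  lemma : ∀ i j p q m → (i + p * m) * (j + q * m) ≡ i * j + (p * j + i * q + p * q * m) * m
  lemma = solve-∀

neg-mod : ∀ {m i j} → i ≡ j [mod m ] → - i ≡ - j [mod m ]
neg-mod {m} {j = j} (congruent q refl) = congruent (- q) (lemma j q (+ m))
  where
  lemma : ∀ j q m → - (j + q * m) ≡ - j + - q * m
  lemma = solve-∀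

sub-mod : ∀ {m i i′ j j′} → i ≡ i′ [mod m ] → j ≡ j′ [mod m ] → i - j ≡ i′ - j′ [mod m ]
sub-mod i≡i′ j≡j′ = +-mod i≡i′ (neg-mod j≡j′)

^-mod : ∀ {m i j} n → i ≡ j [mod m ] → i ^ n ≡ j ^ n [mod m ]
^-mod zero    i≡j = mod-refl
^-mod (suc n) i≡j = *-mod i≡j (^-mod n i≡j)

mod-∣ : ∀ {m i j} c → i ≡ j [mod c ℕ.* m ] → i ≡ j [mod m ]
mod-∣ {m} {j = j} c (congruent q refl) = congruent (q * + c)
  (cong (_+_ j) (trans (cong (q *_) (ℤₚ.pos-* c m)) (sym (ℤₚ.*-assoc q (+ c) (+ m)))))

-- Serves for divisors of `x - 2`, which may be negative; the sign of `k` moves into the quotient.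
mod-∣∣ : ∀ {i j} q k → i ≡ j + q * k → i ≡ j [mod ∣ k ∣ ]
mod-∣∣ q (+ n)    eq = congruent q eq
mod-∣∣ {j = j} q -[1+ n ] eq = congruent (- q) (trans eq (cong (_+_ j) (lemma q (+ suc n))))
  where
  lemma : ∀ q k → q * - k ≡ - q * k
  lemma = solve-∀

pos-mod⇒% : ∀ {m n k} .{{_ : NonZero k}} → + m ≡ + n [mod k ] → m ℕ.% k ≡ n ℕ.% k
pos-mod⇒% {m} {n} {k} (congruent (+ q) eq) =
  trans (cong (ℕ._% k) (ℤₚ.+-injective (trans eq (cong (_+_ (+ n)) (sym (ℤₚ.pos-* q k))))))
        (ℕ.[m+kn]%n≡m%n n q k)
-- With a negative quotient, `n` is `m` plus a positive multiple of `k`, so the two exchange roles.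
pos-mod⇒% {m} {n} {k} c@(congruent -[1+ q ] eq) = sym
  (trans (cong (ℕ._% k) (ℤₚ.+-injective
           (trans (_≡_[mod_].equality (mod-sym c)) (cong (_+_ (+ m)) (sym (ℤₚ.pos-* (suc q) k))))))
         (ℕ.[m+kn]%n≡m%n m (suc q) k))

module _ (m : ℕ) .{{_ : NonZero m}} where

  %ℕ-mod : ∀ i → i ≡ + (i %ℕ m) [mod m ]
  %ℕ-mod i = congruent (i /ℕ m) (a≡a%ℕn+[a/ℕn]*n i m)

  -- Landing in `Fin m` makes residues range over a finite type, so that statements about them can
  -- be decided by `all?`.
  residue : ℤ → Fin m
  residue i = fromℕ< (n%ℕd<d i m)

  residue-mod : ∀ i → i ≡ + toℕ (residue i) [mod m ]
  residue-mod i = mod-trans (%ℕ-mod i) (mod-reflexive (cong +_ (sym (toℕ-fromℕ< (n%ℕd<d i m)))))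

  mod⇒%ℕ : ∀ {i j} → i ≡ j [mod m ] → i %ℕ m ≡ j %ℕ m
  mod⇒%ℕ {i} {j} i≡j =
    trans (sym (ℕ.m<n⇒m%n≡m (n%ℕd<d i m)))
    (trans (pos-mod⇒% (mod-trans (mod-sym (%ℕ-mod i)) (mod-trans i≡j (%ℕ-mod j))))
           (ℕ.m<n⇒m%n≡m (n%ℕd<d j m)))

  %ℕ⇒mod : ∀ {i r} → i %ℕ m ≡ r → i ≡ + r [mod m ]
  %ℕ⇒mod {i} refl = %ℕ-mod i

-- The residue classes ±5 modulo 12.

-- For primes above 3 these are exactly the classes in which 3 is a quadratic non-residue.
±5mod12 : ℤ → Set
±5mod12 i = i %ℕ 12 ≡ 5 ⊎ i %ℕ 12 ≡ 7

±5mod12? : ∀ i → Dec (±5mod12 i)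
±5mod12? i = (i %ℕ 12 ℕ.≟ 5) ⊎-dec (i %ℕ 12 ℕ.≟ 7)

±5mod12-resp : ∀ {i j} → i ≡ j [mod 12 ] → ±5mod12 i → ±5mod12 j
±5mod12-resp i≡j (inj₁ p) = inj₁ (trans (sym (mod⇒%ℕ 12 i≡j)) p)
±5mod12-resp i≡j (inj₂ p) = inj₂ (trans (sym (mod⇒%ℕ 12 i≡j)) p)

±5mod12-neg : ∀ i → ±5mod12 i → ±5mod12 (- i)
±5mod12-neg i p = ±5mod12-resp (mod-sym (neg-mod (residue-mod 12 i)))
  (table (residue 12 i) (±5mod12-resp (residue-mod 12 i) p))
  where
  table : ∀ (r : Fin 12) → ±5mod12 (+ toℕ r) → ±5mod12 (- (+ toℕ r))
  table = from-yes (all? λ (r : Fin 12) → ±5mod12? (+ toℕ r) →-dec ±5mod12? (- (+ toℕ r)))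

±5mod12-∣∣ : ∀ i → ±5mod12 i → ±5mod12 (+ ∣ i ∣)
±5mod12-∣∣ (+ n)    p = p
±5mod12-∣∣ -[1+ n ] p = ±5mod12-neg -[1+ n ] p

-- Descent: 3 is not a square modulo a number in these classes.

parity : ∀ n → ∃[ h ] (n ≡ 2 ℕ.* h ⊎ n ≡ 1 ℕ.+ 2 ℕ.* h)
parity zero = 0 , inj₁ refl
parity (suc n) with parity n
... | h , inj₁ refl = h , inj₂ refl
... | h , inj₂ refl = suc h , inj₁ (lemma h)
  where
  lemma : ∀ h → 2 ℕ.+ 2 ℕ.* h ≡ 2 ℕ.* suc h
  lemma = ℕSolver.solve-∀

even⇒¬±5mod12 : ∀ h → ¬ ±5mod12 (+ (2 ℕ.* h))
even⇒¬±5mod12 h p = table (residue 12 (+ h)) (±5mod12-resp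
  (mod-trans (mod-reflexive (ℤₚ.pos-* 2 h)) (*-mod (mod-refl {i = + 2}) (residue-mod 12 (+ h)))) p)
  where
  table : ∀ (r : Fin 12) → ¬ ±5mod12 (+ 2 * + toℕ r)
  table = from-yes (all? λ (r : Fin 12) → ¬? (±5mod12? (+ 2 * + toℕ r)))

-- Excludes a negative cofactor in the descent, which would force `n ≤ 3`.
±5mod12⇒>3 : ∀ n → ±5mod12 (+ n) → 3 ℕ.< n
±5mod12⇒>3 0 (inj₁ ())
±5mod12⇒>3 0 (inj₂ ())
±5mod12⇒>3 1 (inj₁ ())
±5mod12⇒>3 1 (inj₂ ())
±5mod12⇒>3 2 (inj₁ ())
±5mod12⇒>3 2 (inj₂ ())
±5mod12⇒>3 3 (inj₁ ())
±5mod12⇒>3 3 (inj₂ ())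
±5mod12⇒>3 (suc (suc (suc (suc n)))) _ = s≤s (s≤s (s≤s (s≤s z≤n)))

-- Let `r` be the remainder of `i`. As `n` is odd, one of `r` and `n - r` is even, and both have the
-- square of `i` modulo `n`.
even-square-root : ∀ h i → let n = 1 ℕ.+ 2 ℕ.* h in
                   ∃[ s ] (2 ℕ.* s ℕ.< n × + (2 ℕ.* s) * + (2 ℕ.* s) ≡ i * i [mod n ])
even-square-root h i with parity (i %ℕ suc (2 ℕ.* h))
... | s , inj₁ eq = s , subst (ℕ._< n) eq (n%ℕd<d i n) , *-mod i≡ i≡
  where
  n = suc (2 ℕ.* h)
  i≡ : + (2 ℕ.* s) ≡ i [mod n ]
  i≡ = mod-sym (%ℕ⇒mod n eq)
-- Here `r = 1 + 2t`, so `n - r = 2(h - t)`; the truncated subtraction is exact because `t ≤ h`.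
... | t , inj₂ eq = h ℕ.∸ t , ℕₚ.≤-<-trans (ℕₚ.*-monoʳ-≤ 2 (ℕₚ.m∸n≤m h t)) (ℕₚ.n<1+n _)
                  , mod-trans (*-mod -i≡ -i≡) (mod-reflexive (lemma i))
  where
  n = suc (2 ℕ.* h)
  t≤h : t ℕ.≤ h
  t≤h = ℕₚ.<⇒≤ (ℕₚ.*-cancelˡ-< 2 t h (ℕₚ.≤-pred (subst (ℕ._< n) eq (n%ℕd<d i n))))
  lemma : ∀ i → - i * - i ≡ i * i
  lemma = solve-∀
  sum≡n : ∀ t u → suc (2 ℕ.* t) ℕ.+ 2 ℕ.* u ≡ suc (2 ℕ.* (t ℕ.+ u))
  sum≡n = ℕSolver.solve-∀
  u : ℕ
  u = 2 ℕ.* (h ℕ.∸ t)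
  add-sub : ∀ x y → y ≡ x + y + - x
  add-sub = solve-∀
  one : ∀ n x → n + x ≡ x + 1ℤ * n
  one = solve-∀
  -i≡ : + u ≡ - i [mod n ]
  -i≡ = mod-trans
    (congruent 1ℤ (trans (add-sub (+ suc (2 ℕ.* t)) (+ u))
      (trans (cong (λ w → + w - + suc (2 ℕ.* t))
               (trans (sum≡n t (h ℕ.∸ t)) (cong (λ w → suc (2 ℕ.* w)) (ℕₚ.m+[n∸m]≡n t≤h))))
             (one (+ n) (- (+ suc (2 ℕ.* t)))))))
    (neg-mod (mod-sym (%ℕ⇒mod n eq)))

-- Here `j n = (2s)² - 3` is 1 modulo 4, so `j ≡ n` modulo 4. Modulo 3 it is `s²`: if 3 does not
-- divide `s`, then `j ≡ n` modulo 3 as well; otherwise 3 divides `j`, since `n` is prime to 3.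
cofactor-table : ∀ (n j s : Fin 12) → ±5mod12 (+ toℕ n) →
  (+ 2 * + toℕ s * (+ 2 * + toℕ s) - (+ 3 + + toℕ j * + toℕ n)) %ℕ 12 ≡ 0 →
  ±5mod12 (+ toℕ j) ⊎ (toℕ s ℕ.% 3 ≡ 0 × toℕ j ℕ.% 3 ≡ 0)
cofactor-table = from-yes (all? λ (n : Fin 12) → all? λ (j : Fin 12) → all? λ (s : Fin 12) →
  ±5mod12? (+ toℕ n) →-dec
  (((+ 2 * + toℕ s * (+ 2 * + toℕ s) - (+ 3 + + toℕ j * + toℕ n)) %ℕ 12 ℕ.≟ 0) →-dec
  (±5mod12? (+ toℕ j) ⊎-dec ((toℕ s ℕ.% 3 ℕ.≟ 0) ×-dec (toℕ j ℕ.% 3 ℕ.≟ 0)))))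

-- Here `j n ≡ -1` and `n² ≡ 1` modulo 12, hence `j ≡ -n`.
reduced-cofactor-table : ∀ (n j u : Fin 12) → ±5mod12 (+ toℕ n) →
  (+ 12 * (+ toℕ u * + toℕ u) - (+ 1 + + toℕ j * + toℕ n)) %ℕ 12 ≡ 0 → ±5mod12 (+ toℕ j)
reduced-cofactor-table = from-yes (all? λ (n : Fin 12) → all? λ (j : Fin 12) → all? λ (u : Fin 12) →
  ±5mod12? (+ toℕ n) →-dec
  (((+ 12 * (+ toℕ u * + toℕ u) - (+ 1 + + toℕ j * + toℕ n)) %ℕ 12 ℕ.≟ 0) →-dec ±5mod12? (+ toℕ j)))

no-sqrt-3 : ∀ n → ±5mod12 (+ n) → ∀ i → ¬ (i * i ≡ + 3 [mod n ])
no-sqrt-3 = <-rec _ descent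
  where
  Claim : ℕ → Set
  Claim n = ±5mod12 (+ n) → ∀ i → ¬ (i * i ≡ + 3 [mod n ])

  -- `j n ≤ (2s)² < n²`, and `n` cancels.
  cofactor< : ∀ s j n → 2 ℕ.* s ℕ.< n → (2 ℕ.* s) ℕ.* (2 ℕ.* s) ≡ 3 ℕ.+ j ℕ.* n → j ℕ.< n
  cofactor< s j n 2s<n eq = ℕₚ.*-cancelʳ-< n j n (ℕₚ.≤-<-trans
    (ℕₚ.≤-trans (ℕₚ.m≤n+m (j ℕ.* n) 3) (ℕₚ.≤-reflexive (sym eq))) (ℕₚ.*-mono-< 2s<n 2s<n))

  toℕ-residue-%3 : ∀ k → toℕ (residue 12 (+ k)) ℕ.% 3 ≡ 0 → k ℕ.% 3 ≡ 0
  toℕ-residue-%3 k eq = trans (mod⇒%ℕ 3 (mod-∣ 4 (residue-mod 12 (+ k)))) eq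

  descent : ∀ n → (∀ {m} → m ℕ.< n → Claim m) → Claim n
  descent n rec bad i i²≡3 with parity n
  ... | h , inj₁ refl = even⇒¬±5mod12 h bad
  ... | h , inj₂ refl with even-square-root h i
  ... | s , 2s<n , 2s≡i with mod-trans 2s≡i i²≡3
  -- A negative quotient gives `3 = (2s)² + (j + 1) n ≥ n`.
  ... | congruent -[1+ j ] eq = ℕₚ.<⇒≱ (±5mod12⇒>3 n bad) n≤3
    where
    add-back : ∀ x q n → x ≡ + 3 + - q * n → + 3 ≡ x + q * n
    add-back x q n refl = lemma q n
      where
      lemma : ∀ q n → + 3 ≡ + 3 + - q * n + q * n
      lemma = solve-∀
    3≡ : 3 ≡ (2 ℕ.* s) ℕ.* (2 ℕ.* s) ℕ.+ suc j ℕ.* n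
    3≡ = ℤₚ.+-injective (trans (add-back (+ (2 ℕ.* s) * + (2 ℕ.* s)) (+ suc j) (+ n) eq)
           (cong₂ _+_ (sym (ℤₚ.pos-* (2 ℕ.* s) (2 ℕ.* s))) (sym (ℤₚ.pos-* (suc j) n))))
    n≤3 : n ℕ.≤ 3
    n≤3 = ℕₚ.≤-trans (ℕₚ.m≤m+n n (j ℕ.* n))
            (ℕₚ.≤-trans (ℕₚ.m≤n+m (suc j ℕ.* n) _) (ℕₚ.≤-reflexive (sym 3≡)))
  ... | congruent (+ j) eq = by-cases (cofactor-table (residue 12 (+ n)) (residue 12 (+ j))
      (residue 12 (+ s)) bad′ (mod⇒%ℕ 12 cofactor-mod))
    where
    eqℕ : (2 ℕ.* s) ℕ.* (2 ℕ.* s) ≡ 3 ℕ.+ j ℕ.* n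
    eqℕ = ℤₚ.+-injective (trans (ℤₚ.pos-* (2 ℕ.* s) (2 ℕ.* s))
            (trans eq (cong (_+_ (+ 3)) (sym (ℤₚ.pos-* j n)))))
    j<n : j ℕ.< n
    j<n = cofactor< s j n 2s<n eqℕ
    bad′ : ±5mod12 (+ toℕ (residue 12 (+ n)))
    bad′ = ±5mod12-resp (residue-mod 12 (+ n)) bad
    cofactor-mod : + 2 * + toℕ (residue 12 (+ s)) * (+ 2 * + toℕ (residue 12 (+ s)))
                   - (+ 3 + + toℕ (residue 12 (+ j)) * + toℕ (residue 12 (+ n))) ≡ 0ℤ [mod 12 ]
    cofactor-mod = mod-trans
      (mod-sym (sub-mod (*-mod 2s 2s)
        (+-mod (mod-refl {i = + 3}) (*-mod (residue-mod 12 (+ j)) (residue-mod 12 (+ n))))))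
      (mod-reflexive (ℤₚ.i≡j⇒i-j≡0 eq))
      where
      2s : + (2 ℕ.* s) ≡ + 2 * + toℕ (residue 12 (+ s)) [mod 12 ]
      2s = mod-trans (mod-reflexive (ℤₚ.pos-* 2 s)) (*-mod (mod-refl {i = + 2}) (residue-mod 12 (+ s)))
    by-cases : ±5mod12 (+ toℕ (residue 12 (+ j))) ⊎
               (toℕ (residue 12 (+ s)) ℕ.% 3 ≡ 0 × toℕ (residue 12 (+ j)) ℕ.% 3 ≡ 0) → ⊥
    -- The roles swap: in `(2s)² = 3 + j n`, the smaller `j` becomes the modulus and `n` the
    -- quotient.
    by-cases (inj₁ bad-j) = rec j<n (±5mod12-resp (mod-sym (residue-mod 12 (+ j))) bad-j)
      (+ (2 ℕ.* s)) (congruent (+ n) (trans eq (cong (_+_ (+ 3)) (ℤₚ.*-comm (+ j) (+ n)))))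
    by-cases (inj₂ (3∣s , 3∣j))
      with ℕ.m%n≡0⇒n∣m s 3 (toℕ-residue-%3 s 3∣s) | ℕ.m%n≡0⇒n∣m j 3 (toℕ-residue-%3 j 3∣j)
    -- With `s = 3u` and `j = 3v` the root `2s` is kept and the modulus becomes `v`, with quotient
    -- `3n`. Dividing the equation by 3 gives `12u² = 1 + v n`, which determines the class of `v`.
    ... | ℕ.divides u refl | ℕ.divides v refl = rec (ℕₚ.≤-<-trans (ℕₚ.m≤m*n v 3) j<n) bad-v
        (+ (2 ℕ.* (u ℕ.* 3))) (congruent (+ 3 * + n) (trans eq (trans
          (cong (λ w → + 3 + w * + n) (ℤₚ.pos-* v 3)) (rearrange (+ v) (+ n)))))
      where
      rearrange : ∀ v n → + 3 + v * + 3 * n ≡ + 3 + + 3 * n * v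
      rearrange = solve-∀
      left : ∀ u → (2 ℕ.* (u ℕ.* 3)) ℕ.* (2 ℕ.* (u ℕ.* 3)) ≡ 3 ℕ.* (12 ℕ.* (u ℕ.* u))
      left = ℕSolver.solve-∀
      right : ∀ v n → 3 ℕ.+ v ℕ.* 3 ℕ.* n ≡ 3 ℕ.* (1 ℕ.+ v ℕ.* n)
      right = ℕSolver.solve-∀
      reduced : 12 ℕ.* (u ℕ.* u) ≡ 1 ℕ.+ v ℕ.* n
      reduced = ℕₚ.*-cancelˡ-≡ _ _ 3 (trans (sym (left u)) (trans eqℕ (right v n)))
      reducedℤ : + 12 * (+ u * + u) ≡ + 1 + + v * + n
      reducedℤ = trans (cong (+ 12 *_) (sym (ℤₚ.pos-* u u))) (trans (sym (ℤₚ.pos-* 12 (u ℕ.* u)))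
        (trans (cong +_ reduced) (cong (_+_ (+ 1)) (ℤₚ.pos-* v n))))
      bad-v : ±5mod12 (+ v)
      bad-v = ±5mod12-resp (mod-sym (residue-mod 12 (+ v)))
        (reduced-cofactor-table (residue 12 (+ n)) (residue 12 (+ v)) (residue 12 (+ u)) bad′
          (mod⇒%ℕ 12 (mod-trans
            (mod-sym (sub-mod
              (*-mod (mod-refl {i = + 12}) (*-mod (residue-mod 12 (+ u)) (residue-mod 12 (+ u))))
              (+-mod (mod-refl {i = + 1}) (*-mod (residue-mod 12 (+ v)) (residue-mod 12 (+ n))))))
            (mod-reflexive (ℤₚ.i≡j⇒i-j≡0 reducedℤ)))))

-- Powers modulo 36.

-- Raising `k` by one adds 6 to the exponent, so `x⁹ ≡ x³` suffices. Modulo 4 and modulo 9, either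
-- `x` is a unit with `x⁶ ≡ 1`, or `x³ ≡ 0`. The modulus 36 is a common multiple of the moduli 12
-- and 9 used below.
^-odd-multiple-of-3 : ∀ x k → x ^ ((1 ℕ.+ k ℕ.* 2) ℕ.* 3) ≡ x ^ 3 [mod 36 ]
^-odd-multiple-of-3 x zero    = mod-refl
^-odd-multiple-of-3 x (suc k) = mod-trans (mul⁶ (^-odd-multiple-of-3 x k)) x⁹≡x³
  where
  mul⁶ : ∀ {i j} → i ≡ j [mod 36 ] →
         x * (x * (x * (x * (x * (x * i))))) ≡ x * (x * (x * (x * (x * (x * j))))) [mod 36 ]
  mul⁶ i≡j = mul (mul (mul (mul (mul (mul i≡j)))))
    where
    mul : ∀ {i j} → i ≡ j [mod 36 ] → x * i ≡ x * j [mod 36 ]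
    mul = *-mod (mod-refl {i = x})
  table : ∀ (r : Fin 36) → ((+ toℕ r) ^ 9) %ℕ 36 ≡ ((+ toℕ r) ^ 3) %ℕ 36
  table = from-yes (all? λ (r : Fin 36) → ((+ toℕ r) ^ 9) %ℕ 36 ℕ.≟ ((+ toℕ r) ^ 3) %ℕ 36)
  x⁹≡x³ : x ^ 9 ≡ x ^ 3 [mod 36 ]
  x⁹≡x³ = mod-trans (^-mod 9 x≡) (mod-trans (%ℕ⇒mod 36 (table (residue 36 x)))
            (mod-trans (mod-sym (%ℕ-mod 36 _)) (mod-sym (^-mod 3 x≡))))
    where
    x≡ = residue-mod 36 x

odd-multiple-of-3 : ∀ d → ¬ (2 ℕ.∣ d) → 3 ℕ.∣ d → ∃[ k ] d ≡ (1 ℕ.+ k ℕ.* 2) ℕ.* 3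
odd-multiple-of-3 _ 2∤d (ℕ.divides e refl) with parity e
... | h , inj₁ refl = ⊥-elim (2∤d (ℕ.divides (h ℕ.* 3) (lemma h)))
  where
  lemma : ∀ h → 2 ℕ.* h ℕ.* 3 ≡ h ℕ.* 3 ℕ.* 2
  lemma = ℕSolver.solve-∀
... | h , inj₂ refl = h , cong (λ w → (1 ℕ.+ w) ℕ.* 3) (ℕₚ.*-comm 2 h)

-- The equation modulo 12, modulo 9 and modulo divisors of `x - 2`.

-- The left-hand side of the equation, with p and q standing for xᵈ and 2ᵈ.
form : (a p q x y z : ℤ) → ℤ
form a p q x y z = a * p - y ^ 2 - z ^ 2 + x * y * z - (q * a - + 3)

form-mod : ∀ {m a a′ p p′ q q′ x x′ y y′ z z′} →
           a ≡ a′ [mod m ] → p ≡ p′ [mod m ] → q ≡ q′ [mod m ] →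
           x ≡ x′ [mod m ] → y ≡ y′ [mod m ] → z ≡ z′ [mod m ] →
           form a p q x y z ≡ form a′ p′ q′ x′ y′ z′ [mod m ]
form-mod a p q x y z = sub-mod
  (+-mod (sub-mod (sub-mod (*-mod a p) (^-mod 2 y)) (^-mod 2 z)) (*-mod (*-mod x y) z))
  (sub-mod (*-mod q a) (mod-refl {i = + 3}))

-- Modulo 4 only `x ≡ 1` admits a root. Modulo 3 the class `x ≡ 1` is impossible, since the form
-- becomes `2 - (y + z)²` there.
table-mod-12 : ∀ (x y z : Fin 12) →
  form 1ℤ ((+ toℕ x) ^ 3) (+ 8) (+ toℕ x) (+ toℕ y) (+ toℕ z) %ℕ 12 ≡ 0 → toℕ x ≡ 5 ⊎ toℕ x ≡ 9
table-mod-12 = from-yes (all? λ (x : Fin 12) → all? λ (y : Fin 12) → all? λ (z : Fin 12) →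
  (form 1ℤ ((+ toℕ x) ^ 3) (+ 8) (+ toℕ x) (+ toℕ y) (+ toℕ z) %ℕ 12 ℕ.≟ 0) →-dec
  ((toℕ x ℕ.≟ 5) ⊎-dec (toℕ x ℕ.≟ 9)))

-- As `x³ ≡ 8`, the terms in `a` cancel, leaving `3 - (y - z)² + (x - 2) y z`. Modulo 3 this gives
-- `y ≡ z`, so `(y - z)²` vanishes modulo 9. With `x - 2 = 3m` there remains `m y² ≡ -1` modulo 3,
-- which forces `m ≡ 2`.
table-mod-9 : ∀ (a : Fin 9) → toℕ a ℕ.% 3 ≡ 1 → ∀ (x : Fin 9) → toℕ x ℕ.% 3 ≡ 2 → ∀ (y z : Fin 9) →
  form (+ toℕ a) ((+ toℕ x) ^ 3) (+ 8) (+ toℕ x) (+ toℕ y) (+ toℕ z) %ℕ 9 ≡ 0 → toℕ x ≡ 8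
table-mod-9 = from-yes (all? λ (a : Fin 9) → (toℕ a ℕ.% 3 ℕ.≟ 1) →-dec
  all? λ (x : Fin 9) → (toℕ x ℕ.% 3 ℕ.≟ 2) →-dec all? λ (y : Fin 9) → all? λ (z : Fin 9) →
  (form (+ toℕ a) ((+ toℕ x) ^ 3) (+ 8) (+ toℕ x) (+ toℕ y) (+ toℕ z) %ℕ 9 ℕ.≟ 0) →-dec
  (toℕ x ℕ.≟ 8))

table-5-mod-12 : ∀ (k : Fin 12) → toℕ k ℕ.% 3 ≡ 2 → toℕ k ℕ.% 4 ≡ 1 → ±5mod12 (+ toℕ k)
table-5-mod-12 = from-yes (all? λ (k : Fin 12) →
  (toℕ k ℕ.% 3 ℕ.≟ 2) →-dec (toℕ k ℕ.% 4 ℕ.≟ 1) →-dec ±5mod12? (+ toℕ k))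

-- At x = 2 the form is 3 - (y - z)².
no-±5mod12-divisor : ∀ d a x y z k c → form a (x ^ d) ((+ 2) ^ d) x y z ≡ 0ℤ →
                     x ≡ + 2 + c * k → ¬ ±5mod12 k
no-±5mod12-divisor d a x y z k c eq x≡2+ck bad = no-sqrt-3 ∣ k ∣ (±5mod12-∣∣ k bad) (y - z)
  (mod-trans (mod-reflexive (at-2 a ((+ 2) ^ d) y z))
    (sub-mod (mod-refl {i = + 3}) (mod-trans
      (form-mod (mod-refl {i = a}) (^-mod d (mod-sym x≡2)) (mod-refl {i = (+ 2) ^ d})
                (mod-sym x≡2) (mod-refl {i = y}) (mod-refl {i = z}))
      (mod-reflexive eq))))
  where
  x≡2 : x ≡ + 2 [mod ∣ k ∣ ]
  x≡2 = mod-∣∣ c k x≡2+ck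
  at-2 : ∀ a q y z → (y - z) * (y - z) ≡
         + 3 - (a * q - y * (y * 1ℤ) - z * (z * 1ℤ) + + 2 * y * z - (q * a - + 3))
  at-2 = solve-∀

root-mod-12 : ∀ {a p q} x y z → a ≡ 1ℤ [mod 12 ] → p ≡ x ^ 3 [mod 36 ] → q ≡ + 8 [mod 36 ] →
              form a p q x y z ≡ 0ℤ → x ≡ + 5 [mod 12 ] ⊎ x ≡ + 9 [mod 12 ]
root-mod-12 {a} {p} {q} x y z a≡1 p≡x³ q≡8 eq = Sum.map lift lift
  (table-mod-12 (residue 12 x) (residue 12 y) (residue 12 z) (mod⇒%ℕ 12 (mod-trans
    (mod-sym (form-mod {a = a} {p = p} {q = q} a≡1
      (mod-trans (mod-∣ {12} 3 p≡x³) (^-mod 3 (residue-mod 12 x))) (mod-∣ {12} 3 q≡8)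
      (residue-mod 12 x) (residue-mod 12 y) (residue-mod 12 z)))
    (mod-reflexive eq))))
  where
  lift : ∀ {r} → toℕ (residue 12 x) ≡ r → x ≡ + r [mod 12 ]
  lift x≡r = mod-trans (residue-mod 12 x) (mod-reflexive (cong +_ x≡r))

root-mod-9 : ∀ {a p q} x y z → a ≡ 1ℤ [mod 12 ] → p ≡ x ^ 3 [mod 36 ] → q ≡ + 8 [mod 36 ] →
             form a p q x y z ≡ 0ℤ → x ≡ + 5 [mod 12 ] → x ≡ + 8 [mod 9 ]
root-mod-9 {a} x y z a≡1 p≡x³ q≡8 eq x≡5 =
  mod-trans (residue-mod 9 x) (mod-reflexive (cong +_
    (table-mod-9 (residue 9 a) (%3 a≡1) (residue 9 x) (%3 x≡5) (residue 9 y) (residue 9 z)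
      (mod⇒%ℕ 9 (mod-trans
        (mod-sym (form-mod (residue-mod 9 a) (mod-trans (mod-∣ 4 p≡x³) (^-mod 3 (residue-mod 9 x)))
          (mod-∣ 4 q≡8) (residue-mod 9 x) (residue-mod 9 y) (residue-mod 9 z)))
        (mod-reflexive eq))))))
  where
  %3 : ∀ {i r} → i ≡ r [mod 12 ] → toℕ (residue 9 i) ℕ.% 3 ≡ r %ℕ 3
  %3 {i} i≡r = mod⇒%ℕ 3 (mod-trans (mod-∣ 3 (mod-sym (residue-mod 9 i))) (mod-∣ 4 i≡r))

-- Since `x - 2 ≡ 3` modulo 12 is not itself in the classes ±5, its third is used as the divisor.
±5mod12-third : ∀ {x} → x ≡ + 5 [mod 12 ] → x ≡ + 8 [mod 9 ] →
                ∃[ k ] (x ≡ + 2 + + 3 * k × ±5mod12 k)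
±5mod12-third {x} (congruent p x≡5+12p) (congruent q x≡8+9q) =
  k , x≡2+3k , ±5mod12-resp (mod-sym (residue-mod 12 k)) (table-5-mod-12 (residue 12 k)
    (mod⇒%ℕ 3 {j = + 2} (mod-trans (mod-∣ 4 (mod-sym (residue-mod 12 k))) (congruent q refl)))
    (mod⇒%ℕ 4 {j = 1ℤ} (mod-trans (mod-∣ 3 (mod-sym (residue-mod 12 k))) (congruent p k≡1+4p))))
  where
  -- This is `(x - 2) / 3` read off from `x = 8 + 9q`; from `x = 5 + 12p` the same number is
  -- `1 + 4p`. So `k` is 2 modulo 3 and 1 modulo 4, that is, 5 modulo 12.
  k = + 2 + q * + 3
  rearrange : ∀ q → + 8 + q * + 9 ≡ + 2 + + 3 * (+ 2 + q * + 3)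
  rearrange = solve-∀
  x≡2+3k : x ≡ + 2 + + 3 * k
  x≡2+3k = trans x≡8+9q (rearrange q)
  triple : ∀ p → + 5 + p * + 12 ≡ + 2 + + 3 * (1ℤ + p * + 4)
  triple = solve-∀
  k≡1+4p : k ≡ 1ℤ + p * + 4
  k≡1+4p = ℤₚ.*-cancelˡ-≡ (+ 3) _ _ (∙-cancelˡ (+ 2) _ _
    (trans (sym x≡2+3k) (trans x≡5+12p (triple p))))

no-solution : ∀ d a x y z → a ≡ 1ℤ [mod 12 ] → x ^ d ≡ x ^ 3 [mod 36 ] →
              (+ 2) ^ d ≡ + 8 [mod 36 ] → ¬ (form a (x ^ d) ((+ 2) ^ d) x y z ≡ 0ℤ)
no-solution d a x y z a≡1 xᵈ≡x³ 2ᵈ≡8 eq =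
  Sum.[ x≢5 , x≢9 ] (root-mod-12 {a} {x ^ d} {(+ 2) ^ d} x y z a≡1 xᵈ≡x³ 2ᵈ≡8 eq)
  where
  third : ¬ (∃[ k ] (x ≡ + 2 + + 3 * k × ±5mod12 k))
  third (k , x≡2+3k , bad) = no-±5mod12-divisor d a x y z k (+ 3) eq x≡2+3k bad
  x≢5 : ¬ (x ≡ + 5 [mod 12 ])
  x≢5 x≡5 = third (±5mod12-third x≡5
    (root-mod-9 {a} {x ^ d} {(+ 2) ^ d} x y z a≡1 xᵈ≡x³ 2ᵈ≡8 eq x≡5))
  x≡2+1*[x-2] : ∀ x → x ≡ + 2 + 1ℤ * (x - + 2)
  x≡2+1*[x-2] = solve-∀
  x≢9 : ¬ (x ≡ + 9 [mod 12 ])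
  x≢9 x≡9 = no-±5mod12-divisor d a x y z (x - + 2) 1ℤ eq (x≡2+1*[x-2] x)
    (inj₂ (mod⇒%ℕ 12 {j = + 9 - + 2} (sub-mod x≡9 (mod-refl {i = + 2}))))

∣-1⇒≡1 : ∀ {m a} → (+ m) ∣ (a - 1ℤ) → a ≡ 1ℤ [mod m ]
∣-1⇒≡1 {m} {a} m∣a-1 = from (Signed.∣ᵤ⇒∣ m∣a-1)
  where
  add-back : ∀ i → i ≡ 1ℤ + (i - 1ℤ)
  add-back = solve-∀
  from : (+ m) Signed.∣ (a - 1ℤ) → a ≡ 1ℤ [mod m ]
  from (Signed.divides q a-1≡qm) = congruent q (trans (add-back a) (cong (_+_ 1ℤ) a-1≡qm))

theorem2p1 : (d : ℕ) → 0 ℕ.< d → ¬ (2 ℕ.∣ d) → 3 ℕ.∣ d →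
    (a : ℤ) → (+ 12) ∣ (a - 1ℤ) →
    (b : ℤ) → b ≡ (+ 2) ^ d * a - (+ 3) →
    ¬ (∃[ x ] ∃[ y ] ∃[ z ] a * x ^ d - y ^ 2 - z ^ 2 + x * y * z - b ≡ 0ℤ)
theorem2p1 d _ 2∤d 3∣d a 12∣a-1 b refl (x , y , z , eq) =
  -- The power congruence is used twice: at `x`, and at 2, where it gives `2ᵈ ≡ 2³ = 8`.
  no-solution d a x y z (∣-1⇒≡1 12∣a-1) (^d≡^3 x) (^d≡^3 (+ 2)) eq
  where
  ^d≡^3 : ∀ i → i ^ d ≡ i ^ 3 [mod 36 ]
  ^d≡^3 i = from (odd-multiple-of-3 d 2∤d 3∣d)
    where
    from : ∃[ k ] d ≡ (1 ℕ.+ k ℕ.* 2) ℕ.* 3 → i ^ d ≡ i ^ 3 [mod 36 ]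
    from (k , d≡) = subst (λ e → i ^ e ≡ i ^ 3 [mod 36 ]) (sym d≡) (^-odd-multiple-of-3 i k)
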